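{- Let $r_1,s_1,r_2,s_2\ge2$ be integers, let $\boldsymbol{\lambda}=(\lambda_1,\lambda_2)\in(0,\infty)^2$, and put $h_i=r_i+s_i-1$ for $i\in\{1,2\}$ and $h_*=\min\{h_1,h_2\}$. Then for every $n$, $$\overline{\mathrm{M}}_{\boldsymbol{\lambda}}(n;\mathcal{S}_{r_1,s_1},\mathcal{S}_{r_2,s_2})\ \le\ \min\{\lambda_1B_{h_1}(n),\ \lambda_2B_{h_2}(n)\},$$ where $B_h(n)=\binom{\lfloor n/2\rfloor}{h}+\binom{\lceil n/2\rceil}{h}$. Moreover, the balanced split minimizes the resulting monochromatic count for the internal color: for each $j\in\{1,2\}$, among the two-interval colorings $\chi_{j,x}$ with $0\le x\le n$, the number $N_j(\chi_{j,x};\mathcal{S}_{r_j,s_j})$ is minimized by $x=\lfloor n/2\rfloor$. Therefore $$\pi_{\boldsymbol{\lambda}}(\mathcal{S}_{r_1,s_1},\mathcal{S}_{r_2,s_2})\ \le\ \Bigl(\min_{\{i\in\{1,2\}:\,h_i=h_*\}}\lambda_i\Bigr)\,2^{1-h_*}.$$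
   Context: An ordered graph is a finite graph with a linear order on its vertex set. $\mathcal{K}_n$ is the complete graph on $[n]=\{1,\ldots,n\}$ with the natural order. For integers $r,s\ge1$, $\mathcal{S}_{r,s}$ is the ordered star whose center has $r-1$ leaves to its left (preceding it) and $s-1$ leaves to its right (following it); it has $r+s-1$ vertices, and it is two-sided when $r,s\ge2$. An order-preserving copy of an ordered graph $\mathcal{H}$ in $\mathcal{G}$ is an injective map $V(\mathcal{H})\to V(\mathcal{G})$ that preserves the vertex order and maps every edge of $\mathcal{H}$ to an edge of $\mathcal{G}$; copies are counted by their vertex sets. For ordered graphs $\mathcal{G}_1,\mathcal{G}_2$ and a coloring $\chi:E(\mathcal{K}_n)\to\{1,2\}$, $N_i(\chi;\mathcal{G}_i)$ is the number of order-preserving copies of $\mathcal{G}_i$ in $\mathcal{K}_n$ all of whose edges have color $i$. The weighted ordered multiplicity is $$\overline{\mathrm{M}}_{\boldsymbol{\lambda}}(n;\mathcal{G}_1,\mathcal{G}_2)=\min_{\chi:E(\mathcal{K}_n)\to\{1,2\}}\bigl(\lambda_1N_1(\chi;\mathcal{G}_1)+\lambda_2N_2(\chi;\mathcal{G}_2)\bigr),$$ and $\pi_{\boldsymbol{\lambda}}(\mathcal{G}_1,\mathcal{G}_2)=\lim_{n\to\infty}\overline{\mathrm{M}}_{\boldsymbol{\lambda}}(n;\mathcal{G}_1,\mathcal{G}_2)/\binom{n}{h_*}$, where $h_*$ is the smaller of the numbers of vertices of $\mathcal{G}_1,\mathcal{G}_2$ (the limit exists). For $j\in\{1,2\}$ and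 $0\le x\le n$, the two-interval coloring $\chi_{j,x}$ with internal color $j$ is obtained by splitting $[n]$ into consecutive intervals $A=\{1,\ldots,x\}$ and $B=\{x+1,\ldots,n\}$, giving color $j$ to all edges inside $A$ and all edges inside $B$, and giving the other color to every edge between $A$ and $B$. Convention: $\binom{x}{q}=0$ when $q<0$ or $q>x$. -}

module Defs where

open import Data.Nat.Base as ℕ using (ℕ; zero; suc)
open import Data.Nat.Properties as ℕ using ()
open import Data.Nat.Combinatorics using (_C_)
open import Data.Bool.Base using (if_then_else_; _xor_)
open import Data.Fin.Base as Fin using (Fin; zero; suc; toℕ; opposite)
open import Data.Fin.Patterns using (0F; 1F)
open import Data.Fin.Properties as Fin using (any?; all?; ∀-cons)
open import Data.Fin.Subset using (Subset; inside; outside; _∈_)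
open import Data.Fin.Subset.Properties using (_∈?_)
open import Data.Integer.Base using (+_)
open import Data.List.Base as List using (List; []; _∷_; filter; length)
open import Data.List.NonEmpty as List⁺ using (List⁺; _∷_; toList)
open import Data.List.NonEmpty.Properties using (toList->>=)
open import Data.List.Relation.Unary.Any as Any using (Any; here; there)
open import Data.List.Relation.Unary.Any.Properties using (map⁺; concatMap⁺)
open import Data.Vec.Base using ([]; _∷_)
open import Data.Product.Base using (_×_; _,_; ∃; proj₁; proj₂)
open import Data.Rational.Base as ℚ using (ℚ; 0ℚ; 1ℚ)
import Data.Rational.Properties as ℚ
open import Data.Rational.Solver using (module +-*-Solver)
open import Data.Sum.Base using (_⊎_; inj₁; inj₂)
open import Function.Base using (_∘_)
open import Function.Bundles using (_⇔_; mk⇔; Equivalence)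
open import Relation.Binary.Core using (Rel)
open import Relation.Binary.Definitions using (Symmetric; Irreflexive; tri<; tri≈; tri>)
import Relation.Binary.Definitions as Binary
open import Relation.Binary.PropositionalEquality
  using (_≡_; _≢_; _≗_; refl; sym; trans; cong; subst; subst₂)
open import Relation.Nullary.Decidable
  using (Dec; yes; no; does; map′; ¬?; _×-dec_; _⊎-dec_; _→-dec_)
open import Relation.Nullary.Negation using (contradiction-irr; contradiction)
open import Relation.Unary using (Decidable)
open import Level using (0ℓ)

Eventually : (ℕ → Set) → Set
Eventually P = ∃ λ N → ∀ n → N ℕ.≤ n → P n

-- Real numbers as Cauchy sequences of rationals, with the modulus of
-- convergence carried by the Cauchy proof.  Two sequences with the same
-- limit denote the same real; the relations below respect this.
record ℝ : Set where
  constructor mkℝ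
  field
    seq    : ℕ → ℚ
    cauchy : ∀ ε → 0ℚ ℚ.< ε →
             ∃ λ N → ∀ m n → N ℕ.≤ m → N ℕ.≤ n → ℚ.∣ seq m ℚ.- seq n ∣ ℚ.≤ ε

open ℝ public

infix 4 _≤ᴿ_ _<ᴿ_

_≤ᴿ_ : Rel ℝ 0ℓ
x ≤ᴿ y = ∀ ε → 0ℚ ℚ.< ε → Eventually λ n → seq x n ℚ.≤ seq y n ℚ.+ ε

_<ᴿ_ : Rel ℝ 0ℓ
x <ᴿ y = ∃ λ ε → 0ℚ ℚ.< ε × Eventually λ n → seq x n ℚ.+ ε ℚ.≤ seq y n

private
  open +-*-Solver using (solve; _:=_; _:+_; _:*_; _:-_; :-_)

  p-q≤ε⇒p≤q+ε : ∀ {p q ε} → ℚ.∣ p ℚ.- q ∣ ℚ.≤ ε → p ℚ.≤ q ℚ.+ ε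
  p-q≤ε⇒p≤q+ε {p} {q} {ε} d = begin
    p                          ≡⟨ solve 2 (λ p q → p := q :+ (p :- q)) refl p q ⟩
    q ℚ.+ (p ℚ.- q)            ≤⟨ ℚ.+-monoʳ-≤ q (≤∣∣ (p ℚ.- q)) ⟩
    q ℚ.+ ℚ.∣ p ℚ.- q ∣        ≤⟨ ℚ.+-monoʳ-≤ q d ⟩
    q ℚ.+ ε                    ∎
    where
    open ℚ.≤-Reasoning
    ≤∣∣ : ∀ x → x ℚ.≤ ℚ.∣ x ∣
    ≤∣∣ x with ℚ.≤-total 0ℚ x
    ... | inj₁ 0≤x = ℚ.≤-reflexive (sym (ℚ.0≤p⇒∣p∣≡p 0≤x))
    ... | inj₂ x≤0 = ℚ.≤-trans x≤0 (ℚ.0≤∣p∣ x)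

  flip-∣-∣ : ∀ p q → ℚ.∣ p ℚ.- q ∣ ≡ ℚ.∣ q ℚ.- p ∣
  flip-∣-∣ p q = trans (cong ℚ.∣_∣ (solve 2 (λ p q → p :- q := :- (q :- p)) refl p q))
                       (ℚ.∣-p∣≡∣p∣ (q ℚ.- p))

  near : ∀ {p q ε} → p ℚ.≤ q ℚ.+ ε → q ℚ.≤ p ℚ.+ ε → ℚ.∣ p ℚ.- q ∣ ℚ.≤ ε
  near {p} {q} {ε} p≤ q≤ with ℚ.∣p∣≡p∨∣p∣≡-p (p ℚ.- q)
  ... | inj₁ eq = begin
    ℚ.∣ p ℚ.- q ∣        ≡⟨ eq ⟩
    p ℚ.- q              ≤⟨ ℚ.+-monoˡ-≤ (ℚ.- q) p≤ ⟩
    (q ℚ.+ ε) ℚ.- q      ≡⟨ solve 2 (λ q ε → (q :+ ε) :- q := ε) refl q ε ⟩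
    ε                    ∎
    where open ℚ.≤-Reasoning
  ... | inj₂ eq = begin
    ℚ.∣ p ℚ.- q ∣        ≡⟨ eq ⟩
    ℚ.- (p ℚ.- q)        ≡⟨ solve 2 (λ p q → :- (p :- q) := q :- p) refl p q ⟩
    q ℚ.- p              ≤⟨ ℚ.+-monoˡ-≤ (ℚ.- p) q≤ ⟩
    (p ℚ.+ ε) ℚ.- p      ≡⟨ solve 2 (λ q ε → (q :+ ε) :- q := ε) refl p ε ⟩
    ε                    ∎
    where open ℚ.≤-Reasoning

  ⊓-near : ∀ {a b c d ε} → a ℚ.≤ c ℚ.+ ε → b ℚ.≤ d ℚ.+ ε → a ℚ.⊓ b ℚ.≤ (c ℚ.⊓ d) ℚ.+ ε
  ⊓-near {a} {b} {c} {d} {ε} p q with ℚ.⊓-sel c d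
  ... | inj₁ eq rewrite eq = ℚ.≤-trans (ℚ.p⊓q≤p a b) p
  ... | inj₂ eq rewrite eq = ℚ.≤-trans (ℚ.p⊓q≤q a b) q

  ∣∣-near : ∀ {a b ε} → ℚ.∣ a ℚ.- b ∣ ℚ.≤ ε → ℚ.∣ a ∣ ℚ.≤ ℚ.∣ b ∣ ℚ.+ ε
  ∣∣-near {a} {b} {ε} d = begin
    ℚ.∣ a ∣                         ≡⟨ cong ℚ.∣_∣ (solve 2 (λ a b → a := b :+ (a :- b)) refl a b) ⟩
    ℚ.∣ b ℚ.+ (a ℚ.- b) ∣           ≤⟨ ℚ.∣p+q∣≤∣p∣+∣q∣ b (a ℚ.- b) ⟩
    ℚ.∣ b ∣ ℚ.+ ℚ.∣ a ℚ.- b ∣       ≤⟨ ℚ.+-monoʳ-≤ ℚ.∣ b ∣ d ⟩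
    ℚ.∣ b ∣ ℚ.+ ε                   ∎
    where open ℚ.≤-Reasoning

  pos*pos : ∀ r {ε} .{{_ : ℚ.Positive r}} → 0ℚ ℚ.< ε → 0ℚ ℚ.< r ℚ.* ε
  pos*pos r {ε} 0<ε = subst (ℚ._< r ℚ.* ε) (ℚ.*-zeroʳ r) (ℚ.*-monoʳ-<-pos r 0<ε)

fromℚ : ℚ → ℝ
seq    (fromℚ q) _ = q
cauchy (fromℚ q) ε 0<ε = 0 , λ _ _ _ _ →
  subst (ℚ._≤ ε) (sym (cong ℚ.∣_∣ (ℚ.+-inverseʳ q))) (ℚ.<⇒≤ 0<ε)

0ᴿ : ℝ
0ᴿ = fromℚ 0ℚ

infixl 6 _+ᴿ_ _-ᴿ_
infixl 7 _⊓ᴿ_ _*ᴿ_ _/ᴿ_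
infixr 7 _•_

_+ᴿ_ : ℝ → ℝ → ℝ
seq    (x +ᴿ y) n = seq x n ℚ.+ seq y n
cauchy (x +ᴿ y) ε 0<ε with cauchy x (ℚ.½ ℚ.* ε) (pos*pos ℚ.½ 0<ε)
                         | cauchy y (ℚ.½ ℚ.* ε) (pos*pos ℚ.½ 0<ε)
... | N , p | N′ , p′ = N ℕ.⊔ N′ , λ m n m≥ n≥ →
  let a = seq x m ; b = seq y m ; c = seq x n ; d = seq y n in begin
    ℚ.∣ (a ℚ.+ b) ℚ.- (c ℚ.+ d) ∣
      ≡⟨ cong ℚ.∣_∣ (solve 4 (λ a b c d → (a :+ b) :- (c :+ d) := (a :- c) :+ (b :- d)) refl a b c d) ⟩
    ℚ.∣ (a ℚ.- c) ℚ.+ (b ℚ.- d) ∣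
      ≤⟨ ℚ.∣p+q∣≤∣p∣+∣q∣ (a ℚ.- c) (b ℚ.- d) ⟩
    ℚ.∣ a ℚ.- c ∣ ℚ.+ ℚ.∣ b ℚ.- d ∣
      ≤⟨ ℚ.+-mono-≤ (p m n (ℕ.m⊔n≤o⇒m≤o N N′ m≥) (ℕ.m⊔n≤o⇒m≤o N N′ n≥))
                    (p′ m n (ℕ.m⊔n≤o⇒n≤o N N′ m≥) (ℕ.m⊔n≤o⇒n≤o N N′ n≥)) ⟩
    ℚ.½ ℚ.* ε ℚ.+ ℚ.½ ℚ.* ε
      ≡⟨ sym (ℚ.*-distribʳ-+ ε ℚ.½ ℚ.½) ⟩
    1ℚ ℚ.* ε
      ≡⟨ ℚ.*-identityˡ ε ⟩
    ε ∎
  where open ℚ.≤-Reasoning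

_•_ : ℚ → ℝ → ℝ
seq    (q • x) n = q ℚ.* seq x n
cauchy (q • x) ε 0<ε = proj₁ (cauchy x δ 0<δ) , λ m n m≥ n≥ →
  let d = seq x m ℚ.- seq x n in begin
    ℚ.∣ q ℚ.* seq x m ℚ.- q ℚ.* seq x n ∣
      ≡⟨ cong ℚ.∣_∣ (solve 3 (λ q a b → q :* a :- q :* b := q :* (a :- b)) refl q (seq x m) (seq x n)) ⟩
    ℚ.∣ q ℚ.* d ∣
      ≡⟨ ℚ.∣p*q∣≡∣p∣*∣q∣ q d ⟩
    ℚ.∣ q ∣ ℚ.* ℚ.∣ d ∣
      ≤⟨ ℚ.*-monoʳ-≤-nonNeg ℚ.∣ d ∣ {{ℚ.∣-∣-nonNeg d}} ∣q∣≤c ⟩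
    c ℚ.* ℚ.∣ d ∣
      ≤⟨ ℚ.*-monoˡ-≤-nonNeg c {{ℚ.pos⇒nonNeg c}} (proj₂ (cauchy x δ 0<δ) m n m≥ n≥) ⟩
    c ℚ.* δ
      ≡⟨ sym (ℚ.*-assoc c (ℚ.1/ c) ε) ⟩
    c ℚ.* ℚ.1/ c ℚ.* ε
      ≡⟨ cong (ℚ._* ε) (ℚ.*-inverseʳ c) ⟩
    1ℚ ℚ.* ε
      ≡⟨ ℚ.*-identityˡ ε ⟩
    ε ∎
  where
  open ℚ.≤-Reasoning
  c = ℚ.∣ q ∣ ℚ.+ 1ℚ
  instance
    c>0 : ℚ.Positive c
    c>0 = ℚ.nonNeg+pos⇒pos ℚ.∣ q ∣ {{ℚ.∣-∣-nonNeg q}} 1ℚ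
    c≢0 : ℚ.NonZero c
    c≢0 = ℚ.pos⇒nonZero c
  δ = ℚ.1/ c ℚ.* ε
  0<δ : 0ℚ ℚ.< δ
  0<δ = pos*pos (ℚ.1/ c) {{ℚ.1/pos⇒pos c}} 0<ε
  ∣q∣≤c : ℚ.∣ q ∣ ℚ.≤ c
  ∣q∣≤c = subst (ℚ._≤ c) (ℚ.+-identityʳ ℚ.∣ q ∣) (ℚ.+-monoʳ-≤ ℚ.∣ q ∣ (ℚ.nonNegative⁻¹ 1ℚ))

_-ᴿ_ : ℝ → ℝ → ℝ
x -ᴿ y = x +ᴿ (ℚ.- 1ℚ) • y

∣_∣ᴿ : ℝ → ℝ
seq    ∣ x ∣ᴿ n = ℚ.∣ seq x n ∣
cauchy ∣ x ∣ᴿ ε 0<ε with cauchy x ε 0<ε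
... | N , p = N , λ m n m≥ n≥ →
  near (∣∣-near {seq x m} {seq x n} (p m n m≥ n≥))
       (∣∣-near {seq x n} {seq x m} (p n m n≥ m≥))

_⊓ᴿ_ : ℝ → ℝ → ℝ
seq    (x ⊓ᴿ y) n = seq x n ℚ.⊓ seq y n
cauchy (x ⊓ᴿ y) ε 0<ε with cauchy x ε 0<ε | cauchy y ε 0<ε
... | N , p | N′ , p′ = N ℕ.⊔ N′ , λ m n m≥ n≥ →
  near (half m n m≥ n≥) (half n m n≥ m≥)
  where
  half : ∀ m n → N ℕ.⊔ N′ ℕ.≤ m → N ℕ.⊔ N′ ℕ.≤ n →
         seq x m ℚ.⊓ seq y m ℚ.≤ (seq x n ℚ.⊓ seq y n) ℚ.+ ε
  half m n m≥ n≥ = ⊓-near {seq x m} {seq y m} {seq x n} {seq y n}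
    (p-q≤ε⇒p≤q+ε {seq x m} {seq x n} (p m n (ℕ.m⊔n≤o⇒m≤o N N′ m≥) (ℕ.m⊔n≤o⇒m≤o N N′ n≥)))
    (p-q≤ε⇒p≤q+ε {seq y m} {seq y n} (p′ m n (ℕ.m⊔n≤o⇒n≤o N N′ m≥) (ℕ.m⊔n≤o⇒n≤o N N′ n≥)))

_*ᴿ_ : ℝ → ℕ → ℝ
x *ᴿ k = (+ k ℚ./ 1) • x

-- Division by 0 is given the value 0.
_/ᴿ_ : ℝ → ℕ → ℝ
x /ᴿ zero  = 0ᴿ
x /ᴿ suc k = (+ 1 ℚ./ suc k) • x

_⟶_ : (ℕ → ℝ) → ℝ → Set
a ⟶ L = ∀ ε → 0ℚ ℚ.< ε → Eventually λ n → ∣ a n -ᴿ L ∣ᴿ ≤ᴿ fromℚ ε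

-- Up to isomorphism a finite linearly ordered vertex set is Fin order;
-- vertex v : Fin n stands for the element toℕ v + 1 of [n].
record OrderedGraph : Set₁ where
  field
    order  : ℕ
    Adj    : Rel (Fin order) 0ℓ
    adj?   : Binary.Decidable Adj
    symm   : Symmetric Adj
    irrefl : Irreflexive _≡_ Adj

open OrderedGraph public

K : ℕ → OrderedGraph
K n = record
  { order  = n
  ; Adj    = _≢_
  ; adj?   = λ u v → ¬? (u Fin.≟ v)
  ; symm   = λ u≢v → u≢v ∘ sym
  ; irrefl = λ u≡v u≢v → u≢v u≡v
  }

-- Intended for r , s ≥ 1.  The center is the r-th vertex, at index r ∸ 1.
star : ℕ → ℕ → OrderedGraph
star r s = record
  { order  = r ℕ.+ s ℕ.∸ 1
  ; Adj    = λ u v → u ≢ v × (center u ⊎ center v)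
  ; adj?   = λ u v → ¬? (u Fin.≟ v) ×-dec ((toℕ u ℕ.≟ _) ⊎-dec (toℕ v ℕ.≟ _))
  ; symm   = λ { (u≢v , inj₁ c) → u≢v ∘ sym , inj₂ c
               ; (u≢v , inj₂ c) → u≢v ∘ sym , inj₁ c }
  ; irrefl = λ u≡v uv → proj₁ uv u≡v
  }
  where
  center : Fin (r ℕ.+ s ℕ.∸ 1) → Set
  center u = toℕ u ≡ r ℕ.∸ 1

-- Strict monotonicity subsumes injectivity.
IsCopy : (H G : OrderedGraph) → (Fin (order H) → Fin (order G)) → Set
IsCopy H G f = (∀ u v → u Fin.< v → f u Fin.< f v)
             × (∀ u v → Adj H u v → Adj G (f u) (f v))

-- 0F and 1F are the colors 1 and 2.
Color : Set
Color = Fin 2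

-- An edge of K n is a pair u < v; irrelevance makes the color depend on the pair
-- only.
Coloring : ℕ → Set
Coloring n = (u v : Fin n) → .(u Fin.< v) → Color

AllEdges : ∀ {n} → Coloring n → Color → (H : OrderedGraph) → (Fin (order H) → Fin n) → Set
AllEdges χ c H f = ∀ u v → Adj H u v → (p : f u Fin.< f v) → χ (f u) (f v) p ≡ c

IsVertexSet : ∀ {k n} → (Fin k → Fin n) → Subset n → Set
IsVertexSet f S = ∀ v → v ∈ S ⇔ ∃ λ u → f u ≡ v

SpansCopy : ∀ {n} → Coloring n → Color → OrderedGraph → Subset n → Set
SpansCopy {n} χ c H S = ∃ λ f → IsCopy H (K n) f × AllEdges χ c H f × IsVertexSet f S

∃-map? : ∀ k {n} {P : (Fin k → Fin n) → Set} →
         (∀ {f g} → f ≗ g → P f → P g) → Decidable P → Dec (∃ P)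
∃-map? zero {n} transport P? = map′ (∅ ,_) (λ (_ , p) → transport (λ ()) p) (P? ∅)
  where
  ∅ : Fin 0 → Fin n
  ∅ ()
∃-map? (suc k) {P = P} transport P? = map′
  (λ (x , f , p) → ∀-cons x f , p)
  (λ (f , p) → f zero , f ∘ suc , transport (λ { zero → refl ; (suc _) → refl }) p)
  (any? λ x → ∃-map? k (λ f≗g → transport λ { zero → refl ; (suc i) → f≗g i }) (P? ∘ ∀-cons x))

spansCopy? : ∀ {n} (χ : Coloring n) c H → Decidable (SpansCopy χ c H)
spansCopy? {n} χ c H S = ∃-map? (order H) transport λ f →
  (all? (λ u → all? λ v → (u Fin.<? v) →-dec (f u Fin.<? f v))
    ×-dec all? (λ u → all? λ v → adj? H u v →-dec adj? (K n) (f u) (f v)))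
  ×-dec all? (λ u → all? λ v → adj? H u v →-dec edge? (f u) (f v))
  ×-dec all? (λ v → iff? (v ∈? S) (any? λ u → f u Fin.≟ v))
  where
  edge? : ∀ u v → Dec ((p : u Fin.< v) → χ u v p ≡ c)
  edge? u v with u Fin.<? v
  ... | yes p = map′ (λ eq _ → eq) (λ h → h p) (χ u v p Fin.≟ c)
  ... | no ¬p = yes λ p → contradiction p ¬p

  iff? : ∀ {A B : Set} → Dec A → Dec B → Dec (A ⇔ B)
  iff? a? b? = map′ (λ (f , g) → mk⇔ f g) (λ e → Equivalence.to e , Equivalence.from e)
                    ((a? →-dec b?) ×-dec (b? →-dec a?))

  transport : ∀ {f g} → f ≗ g → IsCopy H (K n) f × AllEdges χ c H f × IsVertexSet f S →
         IsCopy H (K n) g × AllEdges χ c H g × IsVertexSet g S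
  transport {f} {g} f≗g ((mono , edges) , col , vs) =
    ( (λ u v u<v → subst₂ Fin._<_ (f≗g u) (f≗g v) (mono u v u<v))
    , (λ u v a → subst₂ _≢_ (f≗g u) (f≗g v) (edges u v a)) )
    , (λ u v a → subst₂ (λ x y → (p : x Fin.< y) → χ x y p ≡ c) (f≗g u) (f≗g v) (col u v a))
    , λ v → mk⇔
        (λ v∈S → let (u , eq) = Equivalence.to (vs v) v∈S in u , trans (sym (f≗g u)) eq)
        (λ (u , eq) → Equivalence.from (vs v) (u , trans (f≗g u) eq))

subsets : ∀ n → List (Subset n)
subsets zero    = [] ∷ []
subsets (suc n) = List.map (outside ∷_) (subsets n) List.++ List.map (inside ∷_) (subsets n)

-- Copies are counted by their vertex sets, so several embeddings with the same
-- image would count once.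
N : ∀ {n} → Coloring n → Color → OrderedGraph → ℕ
N {n} χ c H = length (filter (spansCopy? χ c H) (subsets n))

choices : ∀ {n} {P : Fin n → Set} → (∀ i → List⁺ (P i)) → List⁺ (∀ i → P i)
choices {zero}  L = (λ ()) ∷ []
choices {suc n} L = List⁺.concatMap (λ p → List⁺.map (∀-cons p) (choices (L ∘ suc))) (L zero)

edgeColors : ∀ {n} (u v : Fin n) → List⁺ (.(u Fin.< v) → Color)
edgeColors u v with u Fin.<? v
... | yes _   = (λ _ → 0F) ∷ (λ _ → 1F) ∷ []
... | no  u≮v = (λ u<v → contradiction-irr u<v u≮v) ∷ []

colorings : ∀ n → List⁺ (Coloring n)
colorings n = choices λ u → choices λ v → edgeColors u v

choices-complete :
  ∀ {n} {P : Fin n → Set} (R : ∀ i → P i → Set) (L : ∀ i → List⁺ (P i)) →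
  (∀ i → Any (R i) (toList (L i))) →
  Any (λ g → ∀ i → R i (g i)) (toList (choices L))
choices-complete {zero}  R L h = here λ ()
choices-complete {suc n} R L h =
  subst (Any _) (toList->>= (λ p → List⁺.map (∀-cons p) (choices (L ∘ suc))) (L zero))
    (concatMap⁺ _ (Any.map
      (λ r → map⁺ (Any.map (λ rs → λ { zero → r ; (suc i) → rs i })
                           (choices-complete (R ∘ suc) (L ∘ suc) (h ∘ suc))))
      (h zero)))

-- This justifies taking the minimum over the list; equality is pointwise for
-- lack of function extensionality.
colorings-complete : ∀ {n} (χ : Coloring n) →
  Any (λ χ′ → ∀ u v .(p : u Fin.< v) → χ′ u v p ≡ χ u v p) (toList (colorings n))
colorings-complete χ =
  choices-complete _ _ λ u → choices-complete (λ v c → .(p : _) → c p ≡ χ u v p) _ (edge u)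
  where
  edge : ∀ u v → Any (λ c → .(p : u Fin.< v) → c p ≡ χ u v p) (toList (edgeColors u v))
  edge u v with u Fin.<? v
  ... | no u≮v = here λ u<v → contradiction-irr u<v u≮v
  ... | yes u<v with χ u v u<v
  ...   | 0F = here λ _ → refl
  ...   | 1F = there (here λ _ → refl)

M̄ : (Color → ℝ) → ℕ → (Color → OrderedGraph) → ℝ
M̄ w n G = List⁺.foldr₁ _⊓ᴿ_ (List⁺.map cost (colorings n))
  where
  cost : Coloring n → ℝ
  cost χ = w 0F *ᴿ N χ 0F (G 0F) +ᴿ w 1F *ᴿ N χ 1F (G 1F)

h⋆ : (Color → OrderedGraph) → ℕ
h⋆ G = order (G 0F) ℕ.⊓ order (G 1F)

-- The quotient takes the junk value 0 only for n < h⋆ G.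
IsMultiplicityDensity : (Color → ℝ) → (Color → OrderedGraph) → ℝ → Set
IsMultiplicityDensity w G π = (λ n → M̄ w n G /ᴿ (n C h⋆ G)) ⟶ π

-- The vertices of A are those of index < x; xor holds exactly for the edges
-- between A and its complement.
twoInterval : ∀ {n} → Color → ℕ → Coloring n
twoInterval j x u v _ =
  if does (toℕ u ℕ.<? x) xor does (toℕ v ℕ.<? x) then opposite j else j

B : ℕ → ℕ → ℕ
B h n = (ℕ.⌊ n /2⌋ C h) ℕ.+ (ℕ.⌈ n /2⌉ C h)

-- The minimum of w i over the i with h i = min (h 0F) (h 1F).
minTied : (Color → ℕ) → (Color → ℝ) → ℝ
minTied h w with ℕ.<-cmp (h 0F) (h 1F)
... | tri< _ _ _ = w 0F
... | tri≈ _ _ _ = w 0F ⊓ᴿ w 1F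
... | tri> _ _ _ = w 1F

{-# OPTIONS --safe #-}

-- In the two-interval coloring χ_{j,x} an edge has color j exactly when its ends
-- lie in the same interval.  A star of color j therefore lies inside A or inside B,
-- which gives C(x,h) + C(n−x,h) copies, and by convexity of C(−,h) the balanced
-- split is optimal.  A star of the other color would have all its leaves across
-- from its center, which is impossible for a two-sided star: every left leaf of a
-- center in A is in A, every right leaf of a center in B is in B.
--
-- For the density no limit has to be computed: on even orders the inequality
-- 2^h C(m,h) ≤ C(2m,h) already bounds the quotient by the limiting constant.

module Submission where

open import Defs
open import Data.Nat.Base using (ℕ; _+_; _∸_; _≤_; _^_; ⌊_/2⌋)
open import Data.Fin.Patterns using (0F; 1F)
open import Data.Product.Base using (_×_)

open import Data.Bool.Base using (Bool; true; false; not; if_then_else_; _xor_)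
import Data.Bool.Properties as Bool
open import Data.Fin.Base as Fin using (Fin; zero; suc; toℕ; fromℕ<; opposite)
import Data.Fin.Properties as Fin
open import Data.Fin.Properties using (∀-cons)
open import Data.Fin.Subset using (Subset; inside; outside; _∈_; _⊆_; ∁; ⊥; ∣_∣)
open import Data.Fin.Subset.Properties
  using (_⊆?_; p⊆q⇒∣p∣≤∣q∣; ∣⊥∣≡0; ∣∁p∣≡n∸∣p∣; x∈p⇒x∉∁p; x∉p⇒x∈∁p; x∈∁p⇒x∉p;
         drop-∷-⊆; drop-there; out⊆; in⊆in)
import Data.Integer.Base as ℤ
import Data.Integer.Properties as ℤ
open import Data.List.Base as List using (List; []; _∷_; _++_; filter; length)
open import Data.List.NonEmpty as List⁺ using (List⁺; _∷_; toList)
open import Data.List.Properties using (filter-≐; filter-none; filter-++; length-++)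
open import Data.List.Relation.Unary.All as All using ()
open import Data.List.Relation.Unary.Any as Any using (Any; here; there)
open import Data.Nat.Base as ℕ using (zero; suc; _*_; _⊓_; ⌈_/2⌉; s≤s; z≤n)
open import Data.Nat.Combinatorics using (_C_; nCk+nC[k+1]≡[n+1]C[k+1]; k>n⇒nCk≡0)
import Data.Nat.Properties as ℕ
open import Data.Nat.Solver using (module +-*-Solver)
open import Data.Product.Base using (_,_; ∃; proj₁; proj₂; map₂)
open import Data.Rational.Base as ℚ using (ℚ; 0ℚ; 1ℚ)
import Data.Rational.Properties as ℚ
open import Data.Rational.Solver renaming (module +-*-Solver to ℚ-Solver)
import Data.Rational.Unnormalised.Base as ℚᵘ
import Data.Rational.Unnormalised.Properties as ℚᵘ
open import Data.Sum.Base using (_⊎_; inj₁; inj₂)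
open import Data.Vec.Base using ([]; _∷_; here; there; lookup; tabulate)
open import Data.Vec.Properties using ([]=⇒lookup; lookup⇒[]=; lookup∘tabulate)
open import Function.Base using (_∘_)
open import Function.Bundles using (mk⇔; Equivalence)
open import Function.Definitions using (Injective)
open import Relation.Binary.Definitions using (tri<; tri≈; tri>)
open import Relation.Binary.PropositionalEquality
open import Relation.Nullary.Decidable using (yes; no; does; dec-true; dec-false; _×-dec_)
open import Relation.Nullary.Negation using (¬_; contradiction)
open import Relation.Unary using (Pred; Decidable; _≐_; _∪_)
open import Relation.Unary.Properties using (_∪?_)

-- Counting list entries that satisfy a decidable predicate.

module _ {a} {A : Set a} where

  count : ∀ {p} {P : Pred A p} → Decidable P → List A → ℕ
  count P? xs = length (filter P? xs)

  count-≐ : ∀ {p q} {P : Pred A p} {Q : Pred A q} (P? : Decidable P) (Q? : Decidable Q) →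
            P ≐ Q → ∀ xs → count P? xs ≡ count Q? xs
  count-≐ P? Q? P≐Q xs = cong length (filter-≐ P? Q? P≐Q xs)

  count-none : ∀ {p} {P : Pred A p} (P? : Decidable P) → (∀ x → ¬ P x) → ∀ xs → count P? xs ≡ 0
  count-none P? ¬P xs = cong length (filter-none P? (All.universal ¬P xs))

  count-++ : ∀ {p} {P : Pred A p} (P? : Decidable P) xs ys →
             count P? (xs ++ ys) ≡ count P? xs + count P? ys
  count-++ P? xs ys = trans (cong length (filter-++ P? xs ys)) (length-++ (filter P? xs))

  count-map : ∀ {b p} {B : Set b} {P : Pred A p} (P? : Decidable P) (f : B → A) xs →
              count P? (List.map f xs) ≡ length (filter (P? ∘ f) xs)
  count-map P? f []       = refl
  count-map P? f (x ∷ xs) with does (P? (f x))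
  ... | true  = cong suc (count-map P? f xs)
  ... | false = count-map P? f xs

  count-∪ : ∀ {p q} {P : Pred A p} {Q : Pred A q} (P? : Decidable P) (Q? : Decidable Q) →
            (∀ x → P x → ¬ Q x) → ∀ xs → count (P? ∪? Q?) xs ≡ count P? xs + count Q? xs
  count-∪ P? Q? disjoint []       = refl
  count-∪ P? Q? disjoint (x ∷ xs) with P? x | Q? x
  ... | yes p | yes q = contradiction q (disjoint x p)
  ... | yes _ | no  _ = cong suc (count-∪ P? Q? disjoint xs)
  ... | no  _ | yes _ = trans (cong suc (count-∪ P? Q? disjoint xs)) (sym (ℕ.+-suc _ _))
  ... | no  _ | no  _ = count-∪ P? Q? disjoint xs

-- Subsets of a given size.

SubsetOfSize : ∀ {n} → ℕ → Subset n → Subset n → Set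
SubsetOfSize h T S = ∣ S ∣ ≡ h × S ⊆ T

subsetOfSize? : ∀ {n} h (T : Subset n) → Decidable (SubsetOfSize h T)
subsetOfSize? h T S = (∣ S ∣ ℕ.≟ h) ×-dec (S ⊆? T)

module _ {n h : ℕ} {S T : Subset n} where

  drop-inside : SubsetOfSize (suc h) (inside ∷ T) (inside ∷ S) → SubsetOfSize h T S
  drop-inside (size , S⊆T) = ℕ.suc-injective size , drop-∷-⊆ S⊆T

  add-inside : SubsetOfSize h T S → SubsetOfSize (suc h) (inside ∷ T) (inside ∷ S)
  add-inside (size , S⊆T) = cong suc size , in⊆in S⊆T

-- Pascal's rule, read off the two halves of `subsets`. The sets without the first vertex contribute
-- `∣ T ∣ C h`. Those with it contribute nothing if `t` is `outside`, and one binomial coefficient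
-- of lower order if `t` is `inside`.
count-subsets : ∀ {n} h (T : Subset n) → count (subsetOfSize? h T) (subsets n) ≡ ∣ T ∣ C h
count-subsets zero    [] = refl
count-subsets (suc h) [] = sym (k>n⇒nCk≡0 {0} {suc h} (s≤s z≤n))
count-subsets {suc n} h (t ∷ T) = begin
  count P? (subsets (suc n))
    ≡⟨ count-++ P? (List.map (outside ∷_) (subsets n)) _ ⟩
  count P? (List.map (outside ∷_) (subsets n)) + count P? (List.map (inside ∷_) (subsets n))
    ≡⟨ cong₂ _+_ (count-map P? _ (subsets n)) (count-map P? _ (subsets n)) ⟩
  count (P? ∘ (outside ∷_)) (subsets n) + count (P? ∘ (inside ∷_)) (subsets n)
    ≡⟨ cong (_+ count (P? ∘ (inside ∷_)) (subsets n)) (trans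
         (count-≐ _ (subsetOfSize? h T) (map₂ drop-∷-⊆ , map₂ out⊆) (subsets n))
         (count-subsets h T)) ⟩
  ∣ T ∣ C h + count (P? ∘ (inside ∷_)) (subsets n)
    ≡⟨ with-first t h ⟩
  ∣ t ∷ T ∣ C h ∎
  where
  open ≡-Reasoning
  P? = subsetOfSize? h (t ∷ T)
  with-first : ∀ t h → ∣ T ∣ C h + count (subsetOfSize? h (t ∷ T) ∘ (inside ∷_)) (subsets n)
                       ≡ ∣ t ∷ T ∣ C h
  with-first outside h = trans
    (cong (∣ T ∣ C h +_) (count-none _ (λ { S (_ , S⊆) → contradiction (S⊆ here) λ () }) (subsets n)))
    (ℕ.+-identityʳ _)
  with-first inside zero = cong (1 +_) (count-none _ (λ { S (() , _) }) (subsets n))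
  with-first inside (suc h) = begin
    ∣ T ∣ C suc h + count (subsetOfSize? (suc h) (inside ∷ T) ∘ (inside ∷_)) (subsets n)
      ≡⟨ cong (∣ T ∣ C suc h +_) (trans
           (count-≐ _ (subsetOfSize? h T)
             (drop-inside , add-inside) (subsets n))
           (count-subsets h T)) ⟩
    ∣ T ∣ C suc h + ∣ T ∣ C h   ≡⟨ ℕ.+-comm (∣ T ∣ C suc h) (∣ T ∣ C h) ⟩
    ∣ T ∣ C h + ∣ T ∣ C suc h   ≡⟨ nCk+nC[k+1]≡[n+1]C[k+1] ∣ T ∣ h ⟩
    suc ∣ T ∣ C suc h           ∎

-- Increasing maps and their vertex sets.

StrictMono : ∀ {k n} → (Fin k → Fin n) → Set
StrictMono f = ∀ u v → u Fin.< v → f u Fin.< f v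

strictMono⇒injective : ∀ {k n} {f : Fin k → Fin n} → StrictMono f → Injective _≡_ _≡_ f
strictMono⇒injective mono {u} {v} fu≡fv with Fin.<-cmp u v
... | tri< u<v _ _ = contradiction fu≡fv (Fin.<⇒≢ (mono u v u<v))
... | tri≈ _ u≡v _ = u≡v
... | tri> _ _ v<u = contradiction (sym fu≡fv) (Fin.<⇒≢ (mono v u v<u))

strictMono-cons : ∀ {k n} {f : Fin k → Fin n} → StrictMono f → StrictMono (∀-cons zero (suc ∘ f))
strictMono-cons mono zero    (suc v) _         = s≤s z≤n
strictMono-cons mono (suc u) (suc v) (s≤s u<v) = s≤s (mono u v u<v)

enumerate : ∀ {n} (S : Subset n) → ∃ λ (f : Fin ∣ S ∣ → Fin n) → StrictMono f × IsVertexSet f S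
enumerate []            = (λ ()) , (λ ()) , λ ()
enumerate (outside ∷ S) with enumerate S
... | f , mono , vs = suc ∘ f , (λ u v u<v → s≤s (mono u v u<v)) , λ where
  zero    → mk⇔ (λ ()) λ ()
  (suc v) → mk⇔
    (λ v∈S → map₂ (cong suc) (Equivalence.to (vs v) (drop-there v∈S)))
    (λ (u , eq) → there (Equivalence.from (vs v) (u , Fin.suc-injective eq)))
enumerate (inside ∷ S) with enumerate S
... | f , mono , vs = ∀-cons zero (suc ∘ f) , strictMono-cons mono , λ where
  zero    → mk⇔ (λ _ → zero , refl) (λ _ → here)
  (suc v) → mk⇔
    (λ v∈S → let (u , eq) = Equivalence.to (vs v) (drop-there v∈S) in suc u , cong suc eq)
    (λ { (zero , ()) ; (suc u , eq) → there (Equivalence.from (vs v) (u , Fin.suc-injective eq)) })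

-- Matching on the size equation retypes the domain of the enumeration, so no cast between `Fin`
-- types appears later.
enumerateOfSize : ∀ {k n} (S : Subset n) → ∣ S ∣ ≡ k →
                  ∃ λ (f : Fin k → Fin n) → StrictMono f × IsVertexSet f S
enumerateOfSize S refl = enumerate S

-- Choosing for each `f u` a preimage under `g` gives an injection from `Fin k` to `Fin l`, because
-- `f` is injective.
vertexSet-size-≤ : ∀ {k l n} {f : Fin k → Fin n} {g : Fin l → Fin n} {S} →
                   StrictMono f → IsVertexSet f S → IsVertexSet g S → k ≤ l
vertexSet-size-≤ {f = f} {g} {S} mono vf vg = Fin.injective⇒≤ {f = proj₁ ∘ preimage} λ {u} {v} eq →
  strictMono⇒injective mono
    (trans (sym (proj₂ (preimage u))) (trans (cong g eq) (proj₂ (preimage v))))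
  where
  preimage : ∀ u → ∃ λ w → g w ≡ f u
  preimage u = Equivalence.to (vg (f u)) (Equivalence.from (vf (f u)) (u , refl))

vertexSet-size : ∀ {k n} {f : Fin k → Fin n} {S} → StrictMono f → IsVertexSet f S → ∣ S ∣ ≡ k
vertexSet-size {S = S} mono vs with enumerate S
... | g , mono′ , vs′ = ℕ.≤-antisym (vertexSet-size-≤ mono′ vs′ vs) (vertexSet-size-≤ mono vs vs′)

-- The two intervals and the colors between them.

inA : ∀ {n} → ℕ → Fin n → Bool
inA x v = does (toℕ v ℕ.<? x)

intervalA : ∀ {n} → ℕ → Subset n
intervalA x = tabulate (inA x)

∣intervalA∣ : ∀ {n} x → x ≤ n → ∣ intervalA {n} x ∣ ≡ x
∣intervalA∣ {zero}  zero    _         = refl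
∣intervalA∣ {suc n} zero    _         = ∣intervalA∣ {n} zero z≤n
∣intervalA∣ {suc n} (suc x) (s≤s x≤n) = cong suc (∣intervalA∣ x x≤n)

module _ {n : ℕ} (x : ℕ) {v : Fin n} where

  inA⇒∈ : inA x v ≡ true → v ∈ intervalA x
  inA⇒∈ eq = lookup⇒[]= v _ (trans (lookup∘tabulate (inA x) v) eq)

  ∈⇒inA : v ∈ intervalA x → inA x v ≡ true
  ∈⇒inA v∈A = trans (sym (lookup∘tabulate (inA x) v)) ([]=⇒lookup v∈A)

  ¬inA⇒∈∁ : inA x v ≡ false → v ∈ ∁ (intervalA x)
  ¬inA⇒∈∁ eq = x∉p⇒x∈∁p λ v∈A → contradiction (trans (sym eq) (∈⇒inA v∈A)) (Bool.not-¬ refl)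

  ∈∁⇒¬inA : v ∈ ∁ (intervalA x) → inA x v ≡ false
  ∈∁⇒¬inA v∈∁A = Bool.¬-not λ eq → x∈∁p⇒x∉p v∈∁A (inA⇒∈ eq)

-- The body of `twoInterval` as a function of the two membership bits; it unfolds to the same term,
-- so questions about colors become Boolean case analysis.
edgeColor : Color → Bool → Bool → Color
edgeColor j a b = if a xor b then opposite j else j

edgeColor-same : ∀ j a → edgeColor j a a ≡ j
edgeColor-same j a = cong (if_then opposite j else j) (Bool.xor-same a)

opposite-≢ : (j : Color) → j ≢ opposite j
opposite-≢ 0F ()
opposite-≢ 1F ()

edgeColor-internal : ∀ j a b → edgeColor j a b ≡ j → b ≡ a
edgeColor-internal j false false _  = refl
edgeColor-internal j false true  eq = contradiction (sym eq) (opposite-≢ j)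
edgeColor-internal j true  false eq = contradiction (sym eq) (opposite-≢ j)
edgeColor-internal j true  true  _  = refl

-- The center of a star and a leaf on each side.

star-center : ∀ {r s} → 1 ≤ r → 1 ≤ s → ∃ λ (c : Fin (r + s ∸ 1)) → toℕ c ≡ r ∸ 1
star-center {suc r} (s≤s _) 1≤s = fromℕ< (ℕ.m<m+n r 1≤s) , Fin.toℕ-fromℕ< _

1≤r+s∸1 : ∀ {r s} → 1 ≤ r → 1 ≤ s → 1 ≤ r + s ∸ 1
1≤r+s∸1 {suc r} (s≤s _) 1≤s = ℕ.≤-trans 1≤s (ℕ.m≤n+m _ r)

star-left-leaf : ∀ {r s} → 2 ≤ r → (c : Fin (r + s ∸ 1)) → toℕ c ≡ r ∸ 1 →
                 ∃ λ (u : Fin (r + s ∸ 1)) → u Fin.< c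
star-left-leaf (s≤s (s≤s _)) c eq = zero , subst (0 ℕ.<_) (sym eq) (s≤s z≤n)

star-right-leaf : ∀ {r s} → 1 ≤ r → 2 ≤ s → (c : Fin (r + s ∸ 1)) → toℕ c ≡ r ∸ 1 →
                  ∃ λ (u : Fin (r + s ∸ 1)) → c Fin.< u
-- Here the center has index `r`, and the chosen leaf is the next vertex, of index `suc r`. It
-- exists because at least one leaf follows the center.
star-right-leaf {suc r} {suc s} (s≤s _) (s≤s 1≤s) c eq = fromℕ< r+1<r+s , (begin-strict
  toℕ c                   ≡⟨ eq ⟩
  r                       <⟨ ℕ.n<1+n r ⟩
  suc r                   ≡⟨ Fin.toℕ-fromℕ< r+1<r+s ⟨
  toℕ (fromℕ< r+1<r+s)    ∎)
  where
  open ℕ.≤-Reasoning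
  r+1<r+s : suc r ℕ.< r + suc s
  r+1<r+s = subst (suc r ℕ.<_) (sym (ℕ.+-suc r s)) (s≤s (ℕ.m<m+n r 1≤s))

-- Monochromatic stars in two-interval colorings.

module _ {n : ℕ} (r s : ℕ) (j : Color) (x : ℕ) {col : Color} {f : Fin (r + s ∸ 1) → Fin n}
         (copy : IsCopy (star r s) (K n) f)
         (mono-col : AllEdges (twoInterval {n} j x) col (star r s) f)
         {c : Fin (r + s ∸ 1)} (c-center : toℕ c ≡ r ∸ 1) where

  -- Edges are colored as increasing pairs, so a leaf may come first or second. Commutativity of
  -- `xor` allows both cases to be stated with the center first.
  leaf-color : ∀ u → u ≢ c → edgeColor j (inA x (f c)) (inA x (f u)) ≡ col
  leaf-color u u≢c with Fin.<-cmp u c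
  ... | tri< u<c _ _ = trans
          (cong (if_then opposite j else j) (Bool.xor-comm (inA x (f c)) (inA x (f u))))
          (mono-col u c (u≢c , inj₂ c-center) (proj₁ copy u c u<c))
  ... | tri≈ _ u≡c _ = contradiction u≡c u≢c
  ... | tri> _ _ c<u = mono-col c u (u≢c ∘ sym , inj₁ c-center) (proj₁ copy c u c<u)

inA-antitone : ∀ {n} x {u v : Fin n} → u Fin.< v → inA x v ≡ true → inA x u ≡ true
inA-antitone x {u} {v} u<v eq with toℕ v ℕ.<? x
... | yes v<x = dec-true (toℕ u ℕ.<? x) (ℕ.<-trans u<v v<x)
... | no  v≮x = contradiction (trans (sym eq) (dec-false (toℕ v ℕ.<? x) v≮x)) λ ()

module _ {n r s : ℕ} (2≤r : 2 ≤ r) (2≤s : 2 ≤ s) (j : Color) (x : ℕ) where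

  private
    1≤r = ℕ.<⇒≤ 2≤r
    1≤s = ℕ.<⇒≤ 2≤s
    h = r + s ∸ 1

  no-external-star : (S : Subset n) → ¬ SpansCopy (twoInterval j x) (opposite j) (star r s) S
  no-external-star S (f , copy@(mono , _) , mono-col , _) = absurd (inA x (f c)) refl
    where
    c        = proj₁ (star-center {r} {s} 1≤r 1≤s)
    c-center = proj₂ (star-center {r} {s} 1≤r 1≤s)
    -- A leaf on the side of the center would be joined to it by an edge of color `j`, while the
    -- star has color `opposite j`.
    crossing : ∀ u → u ≢ c → inA x (f u) ≢ inA x (f c)
    crossing u u≢c eq = opposite-≢ j (trans
      (sym (edgeColor-same j (inA x (f c))))
      (trans (cong (edgeColor j (inA x (f c))) (sym eq)) (leaf-color r s j x copy mono-col c-center u u≢c)))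
    -- The left leaf of a center in A stays in A, and the right leaf of a center outside A stays
    -- outside; either contradicts `crossing`. This uses both `2≤r` and `2≤s`.
    absurd : ∀ b → ¬ inA x (f c) ≡ b
    absurd true c∈A with star-left-leaf {r} {s} 2≤r c c-center
    ... | u , u<c = crossing u (Fin.<⇒≢ u<c)
          (trans (inA-antitone x (mono u c u<c) c∈A) (sym c∈A))
    absurd false c∉A with star-right-leaf {r} {s} 1≤r 2≤s c c-center
    ... | u , c<u = crossing u (Fin.<⇒≢ c<u ∘ sym)
          (trans (Bool.¬-not λ u∈A → contradiction (trans (sym c∉A) (inA-antitone x (mono c u c<u) u∈A)) λ ())
                 (sym c∉A))

  -- In a star of color `j` every leaf lies on the side of the center, so the whole vertex set does.
  -- Conversely all edges within one side have color `j`, so the increasing enumeration of any `h`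
  -- vertices there is a copy.
  internal-star≐ : SpansCopy {n} (twoInterval j x) j (star r s)
                   ≐ SubsetOfSize h (intervalA x) ∪ SubsetOfSize h (∁ (intervalA x))
  internal-star≐ = to , from
    where
    to : ∀ {S} → SpansCopy (twoInterval j x) j (star r s) S →
         (SubsetOfSize h (intervalA x) ∪ SubsetOfSize h (∁ (intervalA x))) S
    to {S} (f , copy@(mono , _) , mono-col , vs) = split (inA x (f c)) refl
      where
      c        = proj₁ (star-center {r} {s} 1≤r 1≤s)
      c-center = proj₂ (star-center {r} {s} 1≤r 1≤s)
      same : ∀ u → inA x (f u) ≡ inA x (f c)
      same u with u Fin.≟ c
      ... | yes u≡c = cong (inA x ∘ f) u≡c
      ... | no  u≢c = edgeColor-internal j _ _ (leaf-color r s j x copy mono-col c-center u u≢c)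
      side : ∀ {v b} → inA x (f c) ≡ b → v ∈ S → inA x v ≡ b
      side {v} eq v∈S with Equivalence.to (vs v) v∈S
      ... | u , refl = trans (same u) eq
      split : ∀ b → inA x (f c) ≡ b →
              (SubsetOfSize h (intervalA x) ∪ SubsetOfSize h (∁ (intervalA x))) S
      split true  eq = inj₁ (vertexSet-size mono vs , inA⇒∈ x ∘ side eq)
      split false eq = inj₂ (vertexSet-size mono vs , ¬inA⇒∈∁ x ∘ side eq)

    onOneSide : ∀ {S b} → ∣ S ∣ ≡ h → (∀ {v} → v ∈ S → inA x v ≡ b) →
                SpansCopy (twoInterval j x) j (star r s) S
    onOneSide {S} {b} size side with enumerateOfSize S size
    ... | f , mono , vs = f , (mono , λ u v uv → proj₁ uv ∘ strictMono⇒injective mono)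
        , (λ u v _ _ → trans (cong₂ (edgeColor j) (f-side u) (f-side v)) (edgeColor-same j b)) , vs
      where
      f-side : ∀ u → inA x (f u) ≡ b
      f-side u = side (Equivalence.from (vs (f u)) (u , refl))

    from : ∀ {S} → (SubsetOfSize h (intervalA x) ∪ SubsetOfSize h (∁ (intervalA x))) S →
           SpansCopy (twoInterval j x) j (star r s) S
    from (inj₁ (size , S⊆A))  = onOneSide size (∈⇒inA x ∘ S⊆A)
    from (inj₂ (size , S⊆∁A)) = onOneSide size (∈∁⇒¬inA x ∘ S⊆∁A)

  N-external : N {n} (twoInterval j x) (opposite j) (star r s) ≡ 0
  N-external = count-none (spansCopy? (twoInterval j x) (opposite j) (star r s)) no-external-star (subsets n)

  N-internal : x ≤ n → N {n} (twoInterval j x) j (star r s) ≡ x C h + (n ∸ x) C h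
  N-internal x≤n = begin
    N {n} (twoInterval j x) j (star r s)
      ≡⟨ count-≐ (spansCopy? (twoInterval j x) j (star r s)) (A? ∪? B?) internal-star≐ (subsets n) ⟩
    count (A? ∪? B?) (subsets n)
      ≡⟨ count-∪ A? B? disjoint (subsets n) ⟩
    count A? (subsets n) + count B? (subsets n)
      ≡⟨ cong₂ _+_ (count-subsets h (intervalA {n} x)) (count-subsets h (∁ (intervalA {n} x))) ⟩
    ∣ intervalA {n} x ∣ C h + ∣ ∁ (intervalA {n} x) ∣ C h
      ≡⟨ cong₂ (λ a b → a C h + b C h) ∣A∣≡x (trans (∣∁p∣≡n∸∣p∣ (intervalA {n} x)) (cong (n ∸_) ∣A∣≡x)) ⟩
    x C h + (n ∸ x) C h ∎
    where
    open ≡-Reasoning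
    ∣A∣≡x = ∣intervalA∣ {n} x x≤n
    A? = subsetOfSize? h (intervalA {n} x)
    B? = subsetOfSize? h (∁ (intervalA {n} x))
    -- A set contained in both sides is empty, but its size `h` is at least 1.
    disjoint : ∀ S → SubsetOfSize h (intervalA x) S → ¬ SubsetOfSize h (∁ (intervalA x)) S
    disjoint S (size , S⊆A) (_ , S⊆∁A) = ℕ.<⇒≱ (1≤r+s∸1 1≤r 1≤s)
      (subst₂ _≤_ size (∣⊥∣≡0 n)
        (p⊆q⇒∣p∣≤∣q∣ {p = S} {⊥} λ v∈S → contradiction (S⊆∁A v∈S) (x∈p⇒x∉∁p (S⊆A v∈S))))

-- Binomial coefficients: convexity and doubling.

C-monoˡ-≤ : ∀ k {m n} → m ≤ n → m C k ≤ n C k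
C-monoˡ-≤ k {m} m≤n with ℕ.m≤n⇒∃[o]m+o≡n m≤n
... | d , refl = grow d
  where
  step : ∀ n k → n C k ≤ suc n C k
  step n zero    = ℕ.≤-refl
  step n (suc k) = subst (n C suc k ≤_) (nCk+nC[k+1]≡[n+1]C[k+1] n k) (ℕ.m≤n+m _ _)
  grow : ∀ d → m C k ≤ (m + d) C k
  grow zero    = ℕ.≤-reflexive (cong (_C k) (sym (ℕ.+-identityʳ m)))
  grow (suc d) = ℕ.≤-trans (grow d) (subst (λ z → (m + d) C k ≤ z C k) (sym (ℕ.+-suc m d)) (step (m + d) k))

-- By Pascal's rule the increment of `_C suc k` at `a` is `a C k`, which is monotone in `a`.
C-convex-step : ∀ k {a b} → a ≤ b → suc a C k + b C k ≤ a C k + suc b C k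
C-convex-step zero    _ = ℕ.≤-refl
C-convex-step (suc k) {a} {b} a≤b = begin
  suc a C suc k + b C suc k             ≡⟨ cong (_+ b C suc k) (nCk+nC[k+1]≡[n+1]C[k+1] a k) ⟨
  (a C k + a C suc k) + b C suc k       ≡⟨ cong (_+ b C suc k) (ℕ.+-comm (a C k) (a C suc k)) ⟩
  (a C suc k + a C k) + b C suc k       ≡⟨ ℕ.+-assoc (a C suc k) (a C k) (b C suc k) ⟩
  a C suc k + (a C k + b C suc k)       ≤⟨ ℕ.+-monoʳ-≤ (a C suc k) (ℕ.+-monoˡ-≤ (b C suc k) (C-monoˡ-≤ k a≤b)) ⟩
  a C suc k + (b C k + b C suc k)       ≡⟨ cong (a C suc k +_) (nCk+nC[k+1]≡[n+1]C[k+1] b k) ⟩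
  a C suc k + suc b C suc k             ∎
  where open ℕ.≤-Reasoning

C-convex : ∀ k d {a b} → a ≤ b → (d + a) C k + b C k ≤ a C k + (d + b) C k
C-convex k zero    _ = ℕ.≤-refl
C-convex k (suc d) {a} {b} a≤b = begin
  suc (d + a) C k + b C k     ≡⟨ cong (λ z → z C k + b C k) (ℕ.+-suc d a) ⟨
  (d + suc a) C k + b C k     ≤⟨ shifted (ℕ.m≤n⇒m<n∨m≡n a≤b) ⟩
  a C k + suc (d + b) C k     ∎
  where
  open ℕ.≤-Reasoning
  -- The induction hypothesis is applied to `suc a`, which requires `a < b`; one application of
  -- `C-convex-step` then finishes. For `a ≡ b` the two sides agree up to commutativity.
  shifted : a ℕ.< b ⊎ a ≡ b → (d + suc a) C k + b C k ≤ a C k + suc (d + b) C k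
  shifted (inj₂ refl) = ℕ.≤-reflexive (trans
    (ℕ.+-comm _ (a C k)) (cong (λ z → a C k + z C k) (ℕ.+-suc d a)))
  shifted (inj₁ a<b) = begin
    (d + suc a) C k + b C k    ≤⟨ C-convex k d a<b ⟩
    suc a C k + (d + b) C k    ≤⟨ C-convex-step k (ℕ.≤-trans a≤b (ℕ.m≤n+m b d)) ⟩
    a C k + suc (d + b) C k    ∎

C-balanced : ∀ k {n a b} → a + b ≡ n → a ≤ b → B k n ≤ a C k + b C k
C-balanced k {n} {a} {b} refl a≤b with ℕ.m≤n⇒∃[o]m+o≡n a≤⌊n/2⌋
  where
  a≤⌊n/2⌋ : a ≤ ⌊ a + b /2⌋
  a≤⌊n/2⌋ = subst (_≤ ⌊ a + b /2⌋) (sym (ℕ.n≡⌊n+n/2⌋ a)) (ℕ.⌊n/2⌋-mono (ℕ.+-monoʳ-≤ a a≤b))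
-- The number `d` is the distance from `a` up to `⌊ n /2⌋`, and equally from `⌈ n /2⌉` up to `b`, so
-- `C-convex` applies to `a` and `⌈ n /2⌉`.
... | d , a+d≡⌊n/2⌋ = begin
  ⌊ n /2⌋ C k + ⌈ n /2⌉ C k       ≡⟨ cong (λ z → z C k + ⌈ n /2⌉ C k) (trans (ℕ.+-comm d a) a+d≡⌊n/2⌋) ⟨
  (d + a) C k + ⌈ n /2⌉ C k       ≤⟨ C-convex k d a≤⌈n/2⌉ ⟩
  a C k + (d + ⌈ n /2⌉) C k       ≡⟨ cong (λ z → a C k + z C k) d+⌈n/2⌉≡b ⟩
  a C k + b C k                   ∎
  where
  open ℕ.≤-Reasoning
  a≤⌈n/2⌉ : a ≤ ⌈ n /2⌉
  a≤⌈n/2⌉ = ℕ.≤-trans (ℕ.m≤m+n a d) (ℕ.≤-trans (ℕ.≤-reflexive a+d≡⌊n/2⌋) (ℕ.⌊n/2⌋≤⌈n/2⌉ n))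
  d+⌈n/2⌉≡b : d + ⌈ n /2⌉ ≡ b
  d+⌈n/2⌉≡b = ℕ.+-cancelˡ-≡ a _ _ (begin-equality
    a + (d + ⌈ n /2⌉)    ≡⟨ ℕ.+-assoc a d _ ⟨
    a + d + ⌈ n /2⌉      ≡⟨ cong (_+ ⌈ n /2⌉) a+d≡⌊n/2⌋ ⟩
    ⌊ n /2⌋ + ⌈ n /2⌉    ≡⟨ ℕ.⌊n/2⌋+⌈n/2⌉≡n n ⟩
    n                    ∎)

B-minimal : ∀ k {n x} → x ≤ n → B k n ≤ x C k + (n ∸ x) C k
B-minimal k {n} {x} x≤n with ℕ.≤-total x (n ∸ x)
... | inj₁ x≤n-x = C-balanced k (ℕ.m+[n∸m]≡n x≤n) x≤n-x
... | inj₂ n-x≤x = subst (B k n ≤_) (ℕ.+-comm ((n ∸ x) C k) _) (C-balanced k (ℕ.m∸n+n≡m x≤n) n-x≤x)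

-- Combinatorially: picking one element from each of `h` out of `m` pairs yields distinct
-- `h`-subsets. The proof is by induction on `m`, with Pascal's rule used once on the left and twice
-- on the right.
2^h*mCh≤[m+m]Ch : ∀ m h → 2 ^ h * (m C h) ≤ (m + m) C h
2^h*mCh≤[m+m]Ch m zero = ℕ.≤-refl
2^h*mCh≤[m+m]Ch zero (suc h) = ℕ.≤-reflexive (trans
  (cong (2 ^ suc h *_) (k>n⇒nCk≡0 {0} {suc h} (s≤s z≤n)))
  (trans (ℕ.*-zeroʳ (2 ^ suc h)) (sym (k>n⇒nCk≡0 {0} {suc h} (s≤s z≤n)))))
2^h*mCh≤[m+m]Ch (suc m) (suc h) = begin
  2 ^ suc h * (suc m C suc h)
    ≡⟨ cong (2 ^ suc h *_) (nCk+nC[k+1]≡[n+1]C[k+1] m h) ⟨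
  2 * 2 ^ h * (m C h + m C suc h)
    ≡⟨ solve 3 (λ p a b → con 2 :* p :* (a :+ b) := con 2 :* (p :* a) :+ con 2 :* p :* b) refl
         (2 ^ h) (m C h) (m C suc h) ⟩
  2 * (2 ^ h * (m C h)) + 2 ^ suc h * (m C suc h)
    ≤⟨ ℕ.+-mono-≤ (ℕ.*-monoʳ-≤ 2 (2^h*mCh≤[m+m]Ch m h)) (2^h*mCh≤[m+m]Ch m (suc h)) ⟩
  2 * (M C h) + M C suc h
    ≡⟨ solve 2 (λ a b → con 2 :* a :+ b := a :+ (a :+ b)) refl (M C h) (M C suc h) ⟩
  M C h + (M C h + M C suc h)
    ≤⟨ ℕ.+-mono-≤ (C-monoˡ-≤ h (ℕ.n≤1+n M)) (ℕ.≤-reflexive (nCk+nC[k+1]≡[n+1]C[k+1] M h)) ⟩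
  suc M C h + suc M C suc h
    ≡⟨ nCk+nC[k+1]≡[n+1]C[k+1] (suc M) h ⟩
  suc (suc M) C suc h
    ≡⟨ cong (λ z → suc z C suc h) (ℕ.+-suc m m) ⟨
  (suc m + suc m) C suc h ∎
  where
  open ℕ.≤-Reasoning
  open +-*-Solver
  M = m + m

-- Both halves of `m + m` are `m`, and the two equal summands of `B` supply the factor 2 that
-- completes `2 ^ (h ∸ 1)` to `2 ^ h`.
B-even : ∀ m {h} → 1 ≤ h → B h (m + m) * 2 ^ (h ∸ 1) ≤ (m + m) C h
B-even m {suc h} (s≤s _) = begin
  B (suc h) (m + m) * 2 ^ h
    ≡⟨ cong₂ (λ a b → (a C suc h + b C suc h) * 2 ^ h) (ℕ.n≡⌊n+n/2⌋ m) (ℕ.n≡⌈n+n/2⌉ m) ⟨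
  (m C suc h + m C suc h) * 2 ^ h
    ≡⟨ solve 2 (λ p a → (a :+ a) :* p := con 2 :* p :* a) refl (2 ^ h) (m C suc h) ⟩
  2 ^ suc h * (m C suc h)
    ≤⟨ 2^h*mCh≤[m+m]Ch m (suc h) ⟩
  (m + m) C suc h ∎
  where
  open ℕ.≤-Reasoning
  open +-*-Solver

B-frequently : ∀ {h k} → h ≡ k → 1 ≤ h → ∀ m → ∃ λ n → m ≤ n × B h n * 2 ^ (k ∸ 1) ≤ n C k
B-frequently refl 1≤h m = m + m , ℕ.m≤m+n m m , B-even m 1≤h

-- Bounding the minimum by the cost of one coloring.

foldr₁-⊓ᴿ-≤ : ∀ {A : Set} (f : A → ℝ) (xs : List⁺ A) {k q} →
              Any (λ a → seq (f a) k ℚ.≤ q) (toList xs) →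
              seq (List⁺.foldr₁ _⊓ᴿ_ (List⁺.map f xs)) k ℚ.≤ q
-- Since `_⊓ᴿ_` acts termwise on sequences, the comparison holds at each index `k` without an error
-- term.
foldr₁-⊓ᴿ-≤ f (x ∷ [])     (here fx≤q) = fx≤q
foldr₁-⊓ᴿ-≤ f (x ∷ y ∷ ys) (here fx≤q) = ℚ.≤-trans (ℚ.p⊓q≤p _ _) fx≤q
foldr₁-⊓ᴿ-≤ f (x ∷ y ∷ ys) (there any) =
  ℚ.≤-trans (ℚ.p⊓q≤q (seq (f x) _) _) (foldr₁-⊓ᴿ-≤ f (y ∷ ys) any)

-- Needed because `colorings-complete` finds a coloring in the list only up to pointwise equality.
N-cong : ∀ {n} {χ χ′ : Coloring n} → (∀ u v .(p : u Fin.< v) → χ u v p ≡ χ′ u v p) →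
         ∀ c H → N χ c H ≡ N χ′ c H
N-cong {χ = χ} {χ′} χ≗χ′ c H = count-≐ (spansCopy? χ c H) (spansCopy? χ′ c H)
  ( (λ (f , copy , col , vs) → f , copy , (λ u v a p → trans (sym (χ≗χ′ _ _ p)) (col u v a p)) , vs)
  , (λ (f , copy , col , vs) → f , copy , (λ u v a p → trans (χ≗χ′ _ _ p) (col u v a p)) , vs)) (subsets _)

+ᴿ-*ᴿ0 : ∀ x y k → seq (x +ᴿ y *ᴿ 0) k ≡ seq x k
+ᴿ-*ᴿ0 x y k = trans (cong (seq x k ℚ.+_) (ℚ.*-zeroˡ (seq y k))) (ℚ.+-identityʳ (seq x k))

*ᴿ0-+ᴿ : ∀ x y k → seq (x *ᴿ 0 +ᴿ y) k ≡ seq y k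
*ᴿ0-+ᴿ x y k = trans (cong (ℚ._+ seq y k) (ℚ.*-zeroˡ (seq x k))) (ℚ.+-identityˡ (seq y k))

M̄≤cost : ∀ w n G (χ : Coloring n) k {a b q} → N χ 0F (G 0F) ≡ a → N χ 1F (G 1F) ≡ b →
         seq (w 0F *ᴿ a +ᴿ w 1F *ᴿ b) k ≡ q → seq (M̄ w n G) k ℚ.≤ q
M̄≤cost w n G χ k refl refl refl = foldr₁-⊓ᴿ-≤ _ (colorings n) (Any.map
  (λ {χ′} eq → ℚ.≤-reflexive (cong₂ (λ a b → seq (w 0F *ᴿ a +ᴿ w 1F *ᴿ b) k)
    (N-cong {χ = χ′} eq 0F (G 0F)) (N-cong {χ = χ′} eq 1F (G 1F))))
  (colorings-complete χ))

-- Inequalities between reals and passage to the limit.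

≤⇒≤ᴿ : ∀ {x y} → Eventually (λ k → seq x k ℚ.≤ seq y k) → x ≤ᴿ y
≤⇒≤ᴿ {x} {y} (K₀ , x≤y) ε 0<ε = K₀ , λ k K₀≤k → begin
  seq x k         ≤⟨ x≤y k K₀≤k ⟩
  seq y k         ≡⟨ ℚ.+-identityʳ (seq y k) ⟨
  seq y k ℚ.+ 0ℚ  ≤⟨ ℚ.+-monoʳ-≤ (seq y k) (ℚ.<⇒≤ 0<ε) ⟩
  seq y k ℚ.+ ε   ∎
  where open ℚ.≤-Reasoning

0<ᴿ⇒0≤ : ∀ {x} → 0ᴿ <ᴿ x → Eventually λ k → 0ℚ ℚ.≤ seq x k
0<ᴿ⇒0≤ (ε , 0<ε , K₀ , p) = K₀ , λ k K₀≤k → ℚ.≤-trans (ℚ.<⇒≤ 0<ε)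
  (subst (ℚ._≤ _) (ℚ.+-identityˡ ε) (p k K₀≤k))

-- After cross-multiplication this is the hypothesis `b * d ≤ c`; unnormalised rationals expose the
-- numerators and denominators.
/-*-≤ : ∀ b c d .{{_ : ℕ.NonZero c}} .{{_ : ℕ.NonZero d}} → b * d ≤ c →
        (ℤ.+ 1 ℚ./ c) ℚ.* (ℤ.+ b ℚ./ 1) ℚ.≤ ℤ.+ 1 ℚ./ d
/-*-≤ b (suc c) (suc d) b*d≤c = ℚ.toℚᵘ-cancel-≤ (begin
  ℚ.toℚᵘ ((ℤ.+ 1 ℚ./ suc c) ℚ.* (ℤ.+ b ℚ./ 1))
    ≃⟨ ℚ.toℚᵘ-homo-* (ℤ.+ 1 ℚ./ suc c) (ℤ.+ b ℚ./ 1) ⟩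
  ℚ.toℚᵘ (ℤ.+ 1 ℚ./ suc c) ℚᵘ.* ℚ.toℚᵘ (ℤ.+ b ℚ./ 1)
    ≃⟨ ℚᵘ.*-cong (ℚ.toℚᵘ-fromℚᵘ (ℚᵘ.mkℚᵘ (ℤ.+ 1) c)) (ℚ.toℚᵘ-fromℚᵘ (ℚᵘ.mkℚᵘ (ℤ.+ b) 0)) ⟩
  ℚᵘ.mkℚᵘ (ℤ.+ 1) c ℚᵘ.* ℚᵘ.mkℚᵘ (ℤ.+ b) 0
    ≤⟨ ℚᵘ.*≤* numerators ⟩
  ℚᵘ.mkℚᵘ (ℤ.+ 1) d
    ≃⟨ ℚ.toℚᵘ-fromℚᵘ (ℚᵘ.mkℚᵘ (ℤ.+ 1) d) ⟨
  ℚ.toℚᵘ (ℤ.+ 1 ℚ./ suc d) ∎)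
  where
  open ℚᵘ.≤-Reasoning
  numerators : (ℤ.+ 1 ℤ.* ℤ.+ b) ℤ.* ℤ.+ suc d ℤ.≤ ℤ.+ 1 ℤ.* ℤ.+ (suc c * 1)
  numerators = subst₂ ℤ._≤_
    (trans (ℤ.pos-* b (suc d)) (cong (ℤ._* ℤ.+ suc d) (sym (ℤ.*-identityˡ (ℤ.+ b)))))
    (trans (cong ℤ.+_ (sym (ℕ.*-identityʳ (suc c)))) (sym (ℤ.*-identityˡ _)))
    (ℤ.+≤+ b*d≤c)

1/-nonNeg : ∀ c .{{_ : ℕ.NonZero c}} → ℚ.NonNegative (ℤ.+ 1 ℚ./ c)
1/-nonNeg c = ℚ.normalize-nonNeg 1 c

/ᴿ-mono : ∀ {x w} b c d .{{_ : ℕ.NonZero d}} {k} → b * d ≤ c → 0ℚ ℚ.≤ seq w k →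
          seq x k ℚ.≤ seq (w *ᴿ b) k → seq (x /ᴿ c) k ℚ.≤ seq (w /ᴿ d) k
-- For `c = 0` the quotient has the default value 0, so nonnegativity of `w` suffices.
/ᴿ-mono {x} {w} b zero (suc d) {k} _ 0≤w _ =
  subst (ℚ._≤ seq (w /ᴿ suc d) k) (ℚ.*-zeroʳ (ℤ.+ 1 ℚ./ suc d))
    (ℚ.*-monoˡ-≤-nonNeg (ℤ.+ 1 ℚ./ suc d) {{1/-nonNeg (suc d)}} 0≤w)
/ᴿ-mono {x} {w} b (suc c) (suc d) {k} b*d≤c 0≤w x≤bw = begin
  (ℤ.+ 1 ℚ./ suc c) ℚ.* seq x k
    ≤⟨ ℚ.*-monoˡ-≤-nonNeg (ℤ.+ 1 ℚ./ suc c) {{1/-nonNeg (suc c)}} x≤bw ⟩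
  (ℤ.+ 1 ℚ./ suc c) ℚ.* ((ℤ.+ b ℚ./ 1) ℚ.* seq w k)
    ≡⟨ ℚ.*-assoc (ℤ.+ 1 ℚ./ suc c) (ℤ.+ b ℚ./ 1) (seq w k) ⟨
  (ℤ.+ 1 ℚ./ suc c) ℚ.* (ℤ.+ b ℚ./ 1) ℚ.* seq w k
    ≤⟨ ℚ.*-monoʳ-≤-nonNeg (seq w k) {{ℚ.nonNegative 0≤w}} (/-*-≤ b (suc c) (suc d) b*d≤c) ⟩
  (ℤ.+ 1 ℚ./ suc d) ℚ.* seq w k ∎
  where open ℚ.≤-Reasoning

⊓ᴿ-glb : ∀ {x y z} → z ≤ᴿ x → z ≤ᴿ y → z ≤ᴿ x ⊓ᴿ y
⊓ᴿ-glb {x} {y} {z} z≤x z≤y ε 0<ε with z≤x ε 0<ε | z≤y ε 0<ε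
... | K₁ , p | K₂ , q = K₁ ℕ.⊔ K₂ , λ k k≥ →
  bound k (p k (ℕ.m⊔n≤o⇒m≤o K₁ K₂ k≥)) (q k (ℕ.m⊔n≤o⇒n≤o K₁ K₂ k≥))
  where
  bound : ∀ k → seq z k ℚ.≤ seq x k ℚ.+ ε → seq z k ℚ.≤ seq y k ℚ.+ ε →
          seq z k ℚ.≤ (seq x k ℚ.⊓ seq y k) ℚ.+ ε
  bound k a b with ℚ.⊓-sel (seq x k) (seq y k)
  ... | inj₁ eq rewrite eq = a
  ... | inj₂ eq rewrite eq = b

/ᴿ-⊓ᴿ : ∀ x y d .{{_ : ℕ.NonZero d}} k → seq ((x /ᴿ d) ⊓ᴿ (y /ᴿ d)) k ≡ seq ((x ⊓ᴿ y) /ᴿ d) k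
/ᴿ-⊓ᴿ x y (suc d) k = sym (ℚ.*-distribˡ-⊓-nonNeg (ℤ.+ 1 ℚ./ suc d) {{1/-nonNeg (suc d)}} (seq x k) (seq y k))

≤ᴿ-respʳ : ∀ {x y z} → (∀ k → seq y k ≡ seq z k) → x ≤ᴿ y → x ≤ᴿ z
≤ᴿ-respʳ {x} eq x≤y ε 0<ε with x≤y ε 0<ε
... | K₀ , p = K₀ , λ k k≥ → subst (λ q → seq x k ℚ.≤ q ℚ.+ ε) (eq k) (p k k≥)

-- The difference is written as `_-ᴿ_` unfolds at a single index.
∣-∣≤⇒≤+ : ∀ {a p ε} → ℚ.∣ a ℚ.+ (ℚ.- 1ℚ) ℚ.* p ∣ ℚ.≤ ε → p ℚ.≤ a ℚ.+ ε
∣-∣≤⇒≤+ {a} {p} {ε} le = begin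
  p                                            ≡⟨ solve 2 (λ a p → p := a :- (a :+ (:- con 1ℚ) :* p)) refl a p ⟩
  a ℚ.- (a ℚ.+ (ℚ.- 1ℚ) ℚ.* p)                  ≤⟨ ℚ.+-monoʳ-≤ a (-x≤∣x∣ (a ℚ.+ (ℚ.- 1ℚ) ℚ.* p)) ⟩
  a ℚ.+ ℚ.∣ a ℚ.+ (ℚ.- 1ℚ) ℚ.* p ∣              ≤⟨ ℚ.+-monoʳ-≤ a le ⟩
  a ℚ.+ ε                                      ∎
  where
  open ℚ.≤-Reasoning
  open ℚ-Solver
  -x≤∣x∣ : ∀ x → ℚ.- x ℚ.≤ ℚ.∣ x ∣
  -x≤∣x∣ x with ℚ.≤-total 0ℚ x
  ... | inj₁ 0≤x = ℚ.≤-trans (ℚ.neg-antimono-≤ 0≤x) (ℚ.0≤∣p∣ x)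
  ... | inj₂ x≤0 = ℚ.≤-reflexive (trans
    (sym (ℚ.0≤p⇒∣p∣≡p (ℚ.neg-antimono-≤ x≤0))) (ℚ.∣-p∣≡∣p∣ x))

-- Since the sequence converges, for each `ε` a single sufficiently late index satisfying the bound
-- is enough. Bounds at arbitrarily late indices therefore suffice, such as those on even orders.
limit-≤ : ∀ {a π y} → a ⟶ π →
          (∀ m → ∃ λ n → m ≤ n × Eventually λ k → seq (a n) k ℚ.≤ seq y k) → π ≤ᴿ y
limit-≤ {a} {π} {y} a⟶π frequently ε 0<ε =
  -- One half of `ε` covers the distance from `a n` to `π`, the other the tolerance built into
  -- `_≤ᴿ_`.
  let δ               = ℚ.½ ℚ.* ε
      0<δ             = subst (ℚ._< δ) (ℚ.*-zeroʳ ℚ.½) (ℚ.*-monoʳ-<-pos ℚ.½ 0<ε)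
      δ+δ≡ε           = trans (sym (ℚ.*-distribʳ-+ ε ℚ.½ ℚ.½)) (ℚ.*-identityˡ ε)
      m , close       = a⟶π δ 0<δ
      n , m≤n , K₁ , aₙ≤y = frequently m
      K₂ , p          = close n m≤n δ 0<δ
  in K₁ ℕ.⊔ K₂ , λ k k≥ → begin
    seq π k                       ≤⟨ ∣-∣≤⇒≤+ {seq (a n) k} {seq π k} {δ ℚ.+ δ} (p k (ℕ.m⊔n≤o⇒n≤o K₁ K₂ k≥)) ⟩
    seq (a n) k ℚ.+ (δ ℚ.+ δ)     ≤⟨ ℚ.+-monoˡ-≤ (δ ℚ.+ δ) (aₙ≤y k (ℕ.m⊔n≤o⇒m≤o K₁ K₂ k≥)) ⟩
    seq y k ℚ.+ (δ ℚ.+ δ)         ≡⟨ cong (seq y k ℚ.+_) δ+δ≡ε ⟩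
    seq y k ℚ.+ ε                 ∎
  where open ℚ.≤-Reasoning

limit-/ᴿ-≤ : ∀ (M : ℕ → ℝ) (c b : ℕ → ℕ) d .{{_ : ℕ.NonZero d}} w π → 0ᴿ <ᴿ w →
             (λ n → M n /ᴿ c n) ⟶ π → (∀ m → ∃ λ n → m ≤ n × b n * d ≤ c n) →
             (∀ n k → seq (M n) k ℚ.≤ seq (w *ᴿ b n) k) → π ≤ᴿ w /ᴿ d
limit-/ᴿ-≤ M c b d w π 0<w lim frequently M≤ = limit-≤ {λ n → M n /ᴿ c n} {π} {w /ᴿ d} lim λ m →
  let n , m≤n , bd≤c = frequently m
      K₀ , 0≤w       = 0<ᴿ⇒0≤ {w} 0<w
  in n , m≤n , K₀ , λ k k≥ → /ᴿ-mono {M n} {w} (b n) (c n) d bd≤c (0≤w k k≥) (M≤ n k)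

≤minTied : ∀ h w d .{{_ : ℕ.NonZero d}} π → (∀ i → h i ≡ h 0F ⊓ h 1F → π ≤ᴿ w i /ᴿ d) →
           π ≤ᴿ minTied h w /ᴿ d
≤minTied h w d π π≤ with ℕ.<-cmp (h 0F) (h 1F)
... | tri< h₀<h₁ _ _ = π≤ 0F (sym (ℕ.m≤n⇒m⊓n≡m (ℕ.<⇒≤ h₀<h₁)))
... | tri> _ _ h₁<h₀ = π≤ 1F (sym (ℕ.m≥n⇒m⊓n≡n (ℕ.<⇒≤ h₁<h₀)))
-- In a tie both weights give a bound, and division by `d` commutes with the minimum.
... | tri≈ _ h₀≡h₁ _ = ≤ᴿ-respʳ {π} {(w 0F /ᴿ d) ⊓ᴿ (w 1F /ᴿ d)} {(w 0F ⊓ᴿ w 1F) /ᴿ d}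
  (/ᴿ-⊓ᴿ (w 0F) (w 1F) d)
  (⊓ᴿ-glb {w 0F /ᴿ d} {w 1F /ᴿ d} {π}
    (π≤ 0F (sym (ℕ.m≤n⇒m⊓n≡m (ℕ.≤-reflexive h₀≡h₁))))
    (π≤ 1F (sym (ℕ.m≥n⇒m⊓n≡n (ℕ.≤-reflexive (sym h₀≡h₁))))))

-- The bounds obtained from the balanced colorings.

module BalancedSplit (w : Color → ℝ) (G : Color → OrderedGraph) (h : Color → ℕ)
  (N-internal≡B : ∀ i n → N {n} (twoInterval i ⌊ n /2⌋) i (G i) ≡ B (h i) n)
  (N-external≡0 : ∀ {i i′} → opposite i ≡ i′ → ∀ n → N {n} (twoInterval i ⌊ n /2⌋) i′ (G i′) ≡ 0)
  where

  -- With internal color `i` the star of the other color contributes no copies, so only `w i` enters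
  -- the cost. The bound is termwise and serves both the finite inequality and the limit.
  M̄≤balanced : ∀ i n k → seq (M̄ w n G) k ℚ.≤ seq (w i *ᴿ B (h i) n) k
  M̄≤balanced 0F n k = M̄≤cost w n G (twoInterval 0F ⌊ n /2⌋) k
    (N-internal≡B 0F n) (N-external≡0 {0F} refl n)
    (+ᴿ-*ᴿ0 (w 0F *ᴿ B (h 0F) n) (w 1F) k)
  M̄≤balanced 1F n k = M̄≤cost w n G (twoInterval 1F ⌊ n /2⌋) k
    (N-external≡0 {1F} refl n) (N-internal≡B 1F n)
    (*ᴿ0-+ᴿ (w 0F) (w 1F *ᴿ B (h 1F) n) k)

  M̄≤⊓ : ∀ n → M̄ w n G ≤ᴿ (w 0F *ᴿ B (h 0F) n) ⊓ᴿ (w 1F *ᴿ B (h 1F) n)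
  M̄≤⊓ n = ⊓ᴿ-glb {w 0F *ᴿ B (h 0F) n} {w 1F *ᴿ B (h 1F) n} {M̄ w n G} (side 0F) (side 1F)
    where
    side : ∀ i → M̄ w n G ≤ᴿ w i *ᴿ B (h i) n
    side i = ≤⇒≤ᴿ {M̄ w n G} {w i *ᴿ B (h i) n} (0 , λ k _ → M̄≤balanced i n k)

  -- Only colors whose `h i` attains the minimum are used: for them `B (h i) n` and the normalizing
  -- binomial coefficient have the same lower index, so `B-frequently` compares them.
  density≤minTied : (∀ i → 0ᴿ <ᴿ w i) → (∀ i → 1 ≤ h i) → (∀ i → h i ≡ order (G i)) →
                    ∀ π → IsMultiplicityDensity w G π → π ≤ᴿ minTied h w /ᴿ (2 ^ (h⋆ G ∸ 1))
  density≤minTied 0<w 1≤h h≡order π lim =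
    ≤minTied h w (2 ^ (h⋆ G ∸ 1)) {{2^≢0}} π λ i hi≡⊓ →
      limit-/ᴿ-≤ (λ n → M̄ w n G) (λ n → n C h⋆ G) (B (h i)) (2 ^ (h⋆ G ∸ 1)) {{2^≢0}}
        (w i) π (0<w i) lim
        (B-frequently {h i} {h⋆ G} (trans hi≡⊓ (cong₂ _⊓_ (h≡order 0F) (h≡order 1F))) (1≤h i))
        (M̄≤balanced i)
    where
    2^≢0 : ℕ.NonZero (2 ^ (h⋆ G ∸ 1))
    2^≢0 = ℕ.m^n≢0 2 (h⋆ G ∸ 1)

theorem3p3 :
    (r s : Color → ℕ) → (∀ i → 2 ≤ r i) → (∀ i → 2 ≤ s i) →
    (w : Color → ℝ) → (∀ i → 0ᴿ <ᴿ w i) →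
    let S = λ i → star (r i) (s i)
        h = λ i → r i + s i ∸ 1
    in (∀ n → M̄ w n S ≤ᴿ (w 0F *ᴿ B (h 0F) n) ⊓ᴿ (w 1F *ᴿ B (h 1F) n))
     × (∀ n j x → x ≤ n →
          N {n} (twoInterval j ⌊ n /2⌋) j (S j) ≤ N {n} (twoInterval j x) j (S j))
     × (∀ π → IsMultiplicityDensity w S π →
          π ≤ᴿ minTied h w /ᴿ (2 ^ (h⋆ S ∸ 1)))
theorem3p3 r s 2≤r 2≤s w 0<w =
    M̄≤⊓
  , (λ n j x x≤n → subst₂ _≤_
      (sym (N-balanced j n)) (sym (N-internal {n} (2≤r j) (2≤s j) j x x≤n))
      (B-minimal (r j + s j ∸ 1) x≤n))
  , density≤minTied 0<w (λ i → 1≤r+s∸1 (ℕ.<⇒≤ (2≤r i)) (ℕ.<⇒≤ (2≤s i))) (λ _ → refl)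
  where
  N-balanced : ∀ i n → N {n} (twoInterval i ⌊ n /2⌋) i (star (r i) (s i)) ≡ B (r i + s i ∸ 1) n
  N-balanced i n = trans (N-internal {n} (2≤r i) (2≤s i) i ⌊ n /2⌋ (ℕ.⌊n/2⌋≤n n))
    (cong (λ z → ⌊ n /2⌋ C (r i + s i ∸ 1) + z C (r i + s i ∸ 1))
      (trans (cong (_∸ ⌊ n /2⌋) (sym (ℕ.⌊n/2⌋+⌈n/2⌉≡n n))) (ℕ.m+n∸m≡n ⌊ n /2⌋ ⌈ n /2⌉)))

  N-opposite : ∀ {i i′} → opposite i ≡ i′ → ∀ n →
               N {n} (twoInterval i ⌊ n /2⌋) i′ (star (r i′) (s i′)) ≡ 0
  N-opposite {i} refl n = N-external {n} (2≤r (opposite i)) (2≤s (opposite i)) i ⌊ n /2⌋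

  open BalancedSplit w (λ i → star (r i) (s i)) (λ i → r i + s i ∸ 1) N-balanced N-opposite
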